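{- For every integer $k\ge 0$, $|I_k(231,321)|=1$, and the unique indecomposable permutation with $k$ inversions avoiding $231$ and $321$ is $(k+1)\,1\,2\,\cdots\,k$.
   Context: A permutation of length $n$ is a word $\pi=\pi_1\cdots\pi_n$ containing each of $1,\dots,n$ exactly once. The sum of permutations $\rho=\rho_1\cdots\rho_n$ and $\tau=\tau_1\cdots\tau_m$ is the permutation $\rho\oplus\tau=\rho_1\cdots\rho_n(n+\tau_1)\cdots(n+\tau_m)$ of length $n+m$. A permutation is decomposable if it equals $\rho\oplus\tau$ for some non-empty permutations $\rho,\tau$; a non-empty permutation that is not decomposable is indecomposable. An inversion of $\pi$ is a pair $(i,j)$ with $i<j$ and $\pi_i>\pi_j$. A permutation $\pi$ contains a permutation (pattern) $\tau=\tau_1\cdots\tau_m$ if there are indices $i_1<\dots<i_m$ such that $\pi_{i_1},\dots,\pi_{i_m}$ is order-isomorphic to $\tau_1,\dots,\tau_m$; otherwise $\pi$ avoids $\tau$. $I_k(\tau_1,\dots,\tau_r)$ denotes the (finite) set of all indecomposable permutations, of any length, with exactly $k$ inversions that avoid all of $\tau_1,\dots,\tau_r$. -}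

module Defs where

open import Data.Fin.Base using (Fin)
import Data.Fin.Base as Fin
import Data.Fin.Properties as Fin
open import Data.List.Base
  using (List; []; _∷_; _++_; map; length; lookup; filter; applyUpTo; allFin; cartesianProduct)
open import Data.List.Membership.Propositional using (_∈_)
open import Data.List.Relation.Binary.Permutation.Propositional using (_↭_)
open import Data.List.Relation.Unary.All using (All)
open import Data.List.Relation.Unary.Unique.Propositional using (Unique)
open import Data.Nat.Base using (ℕ; suc; _+_; _<_; _>_)
open import Data.Nat.Properties using (_>?_)
open import Data.Product.Base using (∃; ∃₂; _×_; _,_)
open import Function.Bundles using (_⇔_)
open import Level using (0ℓ)
open import Relation.Binary.Definitions using (Monotonic₁)
open import Relation.Binary.PropositionalEquality using (_≡_; _≢_)
open import Relation.Nullary using (¬_; _×-dec_)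
open import Relation.Unary using (Pred; Decidable)

Word : Set
Word = List ℕ

-- The word 1 2 ⋯ n.
oneTo : ℕ → Word
oneTo = applyUpTo suc

-- Values are 1-based; positions (elements of Fin (length π)) are 0-based.
IsPermutation : Pred Word 0ℓ
IsPermutation π = π ↭ oneTo (length π)

infixr 6 _⊕_

_⊕_ : Word → Word → Word
ρ ⊕ τ = ρ ++ map (length ρ +_) τ

Decomposable : Pred Word 0ℓ
Decomposable π = ∃₂ λ ρ τ →
  IsPermutation ρ × ρ ≢ [] × IsPermutation τ × τ ≢ [] × π ≡ ρ ⊕ τ

Indecomposable : Pred Word 0ℓ
Indecomposable π = IsPermutation π × π ≢ [] × ¬ Decomposable π

Inversion : (π : Word) → Pred (Fin (length π) × Fin (length π)) 0ℓ
Inversion π (i , j) = i Fin.< j × lookup π i > lookup π j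

inversion? : (π : Word) → Decidable (Inversion π)
inversion? π (i , j) = (i Fin.<? j) ×-dec (lookup π i >? lookup π j)

#inversions : Word → ℕ
#inversions π =
  length (filter (inversion? π)
    (cartesianProduct (allFin (length π)) (allFin (length π))))

Contains : Word → Word → Set
Contains π τ = ∃ λ (f : Fin (length τ) → Fin (length π)) →
  Monotonic₁ Fin._<_ Fin._<_ f ×
  (∀ a b → lookup τ a < lookup τ b ⇔ lookup π (f a) < lookup π (f b))

Avoids : Word → Word → Set
Avoids π τ = ¬ Contains π τ

I : ℕ → List Word → Pred Word 0ℓ
I k τs π = Indecomposable π × #inversions π ≡ k × All (Avoids π) τs

HasCardinality : {A : Set} → Pred A 0ℓ → ℕ → Set
HasCardinality P n = ∃ λ xs →
  Unique xs × (∀ x → x ∈ xs ⇔ P x) × length xs ≡ n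

module Submission where

-- Let π = (m+1) w be a permutation avoiding 231 and 321, and write
-- cycle m = (m+1) 1 2 ⋯ m.  An entry y ≤ m of w has the larger entry m+1 in
-- front of it, so a second larger entry x between the two would complete
-- (m+1) x y to a copy of 231 or 321.  Hence every entry of w that precedes y is
-- smaller than y ("ascends-below-head"), which forces w to begin with 1 2 ⋯ m
-- ("ascending-prefix").  Therefore π = cycle m ⊕ τ for some permutation τ
-- ("cycle⊕"), and if π is indecomposable then τ is empty and π = cycle m.
--
-- Conversely every inversion of cycle m starts at the first position
-- ("inversion-at-head"), so there are exactly m of them ("#inversions-cycle"),
-- and no three-letter pattern whose last two letters descend can occur.  Finally
-- cycle m is indecomposable since its first entry equals its length, whereas for
-- non-empty ρ and τ the first entry of ρ ⊕ τ is at most the length of ρ, hence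
-- less than the length of ρ ⊕ τ.

open import Defs
open import Data.Empty using (⊥-elim)
open import Data.Fin.Base using (Fin; zero; suc)
import Data.Fin.Base as Fin
open import Data.Nat.Base using (ℕ; zero; suc; _+_; _<_; _≤_; _>_; s≤s; z<s; s<s)
open import Data.Nat.Properties
  using (≤-refl; ≤-reflexive; ≤-antisym; ≤-trans; <-trans; <-cmp; <-irrefl; <-asym; <⇒≤; <⇒≢;
         <⇒≱; ≰⇒>; _≤?_; m≤m+n; m<m+n; m≤n⇒∃[o]m+o≡n)
open import Data.List.Base
  using (List; []; _∷_; _++_; map; length; lookup; filter; applyUpTo; allFin; tabulate; cartesianProduct; take)
open import Data.List.Properties
  using (map-applyUpTo; applyUpTo-∷ʳ; length-applyUpTo; lookup-applyUpTo; map-++; map-∘;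
         ++-identityʳ; length-++; length-map; length-tabulate; tabulate-lookup;
         filter-++; filter-all; filter-none)
open import Data.List.Membership.Propositional using (_∈_)
open import Data.List.Membership.Propositional.Properties using (∈-applyUpTo⁻; ∈-lookup)
open import Data.List.Relation.Binary.Permutation.Propositional
  using (_↭_; ↭-sym; ↭-trans; ↭-reflexive; ↭⇒↭ₛ; module PermutationReasoning)
open import Data.List.Relation.Binary.Permutation.Propositional.Properties
  using (∈-resp-↭; ↭-length; ↭-map-inv; drop-∷; ∷↭∷ʳ; ++⁺ʳ)
import Data.List.Relation.Binary.Permutation.Setoid.Properties as Permutationₛ
open import Data.List.Relation.Unary.All as All using (All; []; _∷_)
import Data.List.Relation.Unary.All.Properties as All
open import Data.List.Relation.Unary.AllPairs as AllPairs using (AllPairs; []; _∷_)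
import Data.List.Relation.Unary.AllPairs.Properties as AllPairs
open import Data.List.Relation.Unary.Any using (here; there)
open import Data.List.Relation.Unary.Unique.Propositional using (Unique)
import Data.List.Relation.Unary.Unique.Propositional.Properties as Unique
open import Data.Product.Base using (∃; ∃₂; _×_; _,_; proj₁; proj₂)
open import Data.Sum.Base as Sum using (_⊎_; inj₁; inj₂)
open import Function.Base using (_∘_)
open import Function.Bundles using (_⇔_; mk⇔; Equivalence)
open import Relation.Binary.Definitions using (tri<; tri≈; tri>)
open import Relation.Binary.PropositionalEquality
  using (_≡_; _≢_; refl; sym; trans; cong; cong₂; subst; setoid; module ≡-Reasoning)
open import Relation.Nullary using (¬_; yes; no; contradiction)
open import Relation.Unary using (_≐_; ｛_｝)

-- Permutations as words

oneTo-+ : ∀ m n → oneTo (m + n) ≡ oneTo m ++ map (m +_) (oneTo n)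
oneTo-+ zero    n = sym (map-applyUpTo suc (0 +_) n)
oneTo-+ (suc m) n = cong (1 ∷_) (begin
  applyUpTo (λ i → suc (suc i)) (m + n)
    ≡⟨ map-applyUpTo suc suc (m + n) ⟨
  map suc (oneTo (m + n))
    ≡⟨ cong (map suc) (oneTo-+ m n) ⟩
  map suc (oneTo m ++ map (m +_) (oneTo n))
    ≡⟨ map-++ suc (oneTo m) _ ⟩
  map suc (oneTo m) ++ map suc (map (m +_) (oneTo n))
    ≡⟨ cong₂ _++_ (map-applyUpTo suc suc m) (sym (map-∘ (oneTo n))) ⟩
  applyUpTo (λ i → suc (suc i)) m ++ map (suc m +_) (oneTo n) ∎)
  where open ≡-Reasoning

permutation-unique : ∀ {π} → IsPermutation π → Unique π
permutation-unique {π} π↭ =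
  Permutationₛ.Unique-resp-↭ (setoid ℕ) (↭⇒↭ₛ (↭-sym π↭))
    (Unique.applyUpTo⁺₁ suc (length π) (λ i<j _ → <⇒≢ (s<s i<j)))

permutation-≤ : ∀ {π x} → IsPermutation π → x ∈ π → x ≤ length π
permutation-≤ π↭ x∈π with _ , i<n , refl ← ∈-applyUpTo⁻ suc (∈-resp-↭ π↭ x∈π) = i<n

-- The permutation (m+1) 1 2 ⋯ m, a single cycle on all m+1 points.
cycle : ℕ → Word
cycle m = suc m ∷ oneTo m

length-cycle : ∀ m → length (cycle m) ≡ suc m
length-cycle m = cong suc (length-applyUpTo suc m)

cycle-↭ : ∀ m → cycle m ↭ oneTo (suc m)
cycle-↭ m = ↭-trans (∷↭∷ʳ (suc m) (oneTo m)) (↭-reflexive (applyUpTo-∷ʳ suc m))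

cycle-isPermutation : ∀ m → IsPermutation (cycle m)
cycle-isPermutation m =
  subst (λ n → cycle m ↭ oneTo n) (sym (length-cycle m)) (cycle-↭ m)

-- Permutations avoiding 231 and 321

-- The pairs x, y and p, q are strictly ordered, in the same way.
SameOrder : ℕ → ℕ → ℕ → ℕ → Set
SameOrder x y p q = (x < y × p < q) ⊎ (x > y × p > q)

sameOrder⇒⇔ : ∀ {x y p q} → SameOrder x y p q → x < y ⇔ p < q
sameOrder⇒⇔ (inj₁ (x<y , p<q)) = mk⇔ (λ _ → p<q) (λ _ → x<y)
sameOrder⇒⇔ (inj₂ (x>y , p>q)) =
  mk⇔ (λ x<y → contradiction x<y (<-asym x>y)) (λ p<q → contradiction p<q (<-asym p>q))

irreflexive⇔ : ∀ {x p} → x < x ⇔ p < p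
irreflexive⇔ = mk⇔ (⊥-elim ∘ <-irrefl refl) (⊥-elim ∘ <-irrefl refl)

contains₃ : ∀ {π x y z} {i j l : Fin (length π)} → i Fin.< j → j Fin.< l →
            SameOrder x y (lookup π i) (lookup π j) →
            SameOrder x z (lookup π i) (lookup π l) →
            SameOrder y z (lookup π j) (lookup π l) →
            Contains π (x ∷ y ∷ z ∷ [])
contains₃ {π} {x} {y} {z} {i} {j} {l} i<j j<l xy xz yz = f , mono , order
  where
  f : Fin 3 → Fin (length π)
  f = lookup (i ∷ j ∷ l ∷ [])

  mono : ∀ {a b} → a Fin.< b → f a Fin.< f b
  mono {_}              {zero}           ()
  mono {zero}           {suc zero}       _ = i<j
  mono {zero}           {suc (suc zero)} _ = <-trans i<j j<l
  mono {suc zero}       {suc (suc zero)} _ = j<l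
  mono {suc zero}       {suc zero}       (s≤s ())
  mono {suc (suc zero)} {suc zero}       (s≤s ())
  mono {suc (suc zero)} {suc (suc zero)} (s≤s (s≤s ()))

  order : ∀ a b → lookup (x ∷ y ∷ z ∷ []) a < lookup (x ∷ y ∷ z ∷ []) b ⇔
                  lookup π (f a) < lookup π (f b)
  order zero             zero             = irreflexive⇔
  order zero             (suc zero)       = sameOrder⇒⇔ xy
  order zero             (suc (suc zero)) = sameOrder⇒⇔ xz
  order (suc zero)       zero             = sameOrder⇒⇔ (Sum.swap xy)
  order (suc zero)       (suc zero)       = irreflexive⇔
  order (suc zero)       (suc (suc zero)) = sameOrder⇒⇔ yz
  order (suc (suc zero)) zero             = sameOrder⇒⇔ (Sum.swap xz)
  order (suc (suc zero)) (suc zero)       = sameOrder⇒⇔ (Sum.swap yz)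
  order (suc (suc zero)) (suc (suc zero)) = irreflexive⇔

231₃ 321₃ : Word
231₃ = 2 ∷ 3 ∷ 1 ∷ []
321₃ = 3 ∷ 2 ∷ 1 ∷ []

-- Contrapositively: a descent of w down to an entry below a would form, together
-- with the leading a, one of the two patterns.
ascends-below-head : ∀ {a w} → Unique (a ∷ w) → Avoids (a ∷ w) 231₃ → Avoids (a ∷ w) 321₃ →
                     AllPairs (λ x y → y < a → x ≤ y) w
ascends-below-head {a} {w} (a∉w ∷ _) av231 av321 =
  subst (AllPairs _) (tabulate-lookup w) (AllPairs.tabulate⁺-< ascends)
  where
  ascends : ∀ {i j} → i Fin.< j → lookup w j < a → lookup w i ≤ lookup w j
  ascends {i} {j} i<j y<a with lookup w i ≤? lookup w j
  ... | yes x≤y = x≤y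
  ... | no  x≰y with y<x ← ≰⇒> x≰y with <-cmp a (lookup w i)
  ...   | tri≈ _ a≡x _ = contradiction a≡x (All.lookup a∉w (∈-lookup i))
  -- Here a x y is an occurrence of 231.
  ...   | tri< a<x _ _ = contradiction
            (contains₃ {i = zero} {suc i} {suc j} z<s (s<s i<j)
              (inj₁ (≤-refl , a<x)) (inj₂ (≤-refl , y<a)) (inj₂ (s≤s z<s , y<x)))
            av231
  -- Here a x y is an occurrence of 321.
  ...   | tri> _ _ x<a = contradiction
            (contains₃ {i = zero} {suc i} {suc j} z<s (s<s i<j)
              (inj₂ (≤-refl , x<a)) (inj₂ (s≤s z<s , y<a)) (inj₂ (≤-refl , y<x)))
            av321

-- Wherever the least entry u stands, the first entry x does not exceed it.
head-least : ∀ {a u x us w} → u < a → All (u ≤_) us → All (λ y → y < a → x ≤ y) w →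
             x ∷ w ↭ u ∷ us → x ≡ u
head-least u<a u≤us x≤w xw↭uus with ∈-resp-↭ (↭-sym xw↭uus) (here refl)
... | here u≡x  = sym u≡x
... | there u∈w =
  ≤-antisym (All.lookup x≤w u∈w u<a) (All.lookup (≤-refl ∷ u≤us) (∈-resp-↭ xw↭uus (here refl)))

-- Let w rearrange us ++ vs, where us lists in increasing order the entries below a.
-- If in w no entry below a is preceded by a larger one, then w begins with us: by
-- "head-least" the head of w is the head of us, and so on down the two tails.
ascending-prefix : ∀ {a us vs w} → AllPairs _≤_ us → All (_< a) us → All (a ≤_) vs →
                   AllPairs (λ x y → y < a → x ≤ y) w → w ↭ us ++ vs →
                   ∃ λ rest → w ≡ us ++ rest × rest ↭ vs
ascending-prefix {us = []} _ _ _ _ w↭ = _ , refl , w↭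
ascending-prefix {us = u ∷ us} {w = []} _ _ _ _ w↭ with () ← ↭-length w↭
ascending-prefix {us = u ∷ us} {w = x ∷ w} (u≤us ∷ us-sorted) (u<a ∷ us<a) a≤vs (x≤w ∷ w-ascends) w↭
  with refl ← head-least u<a (All.++⁺ u≤us (All.map (≤-trans (<⇒≤ u<a)) a≤vs)) x≤w w↭
  with rest , w≡ , rest↭ ← ascending-prefix us-sorted us<a a≤vs w-ascends (drop-∷ w↭)
  = rest , cong (u ∷_) w≡ , rest↭

tail-↭ : ∀ m r {w} → suc m ∷ w ↭ oneTo (suc m + r) → w ↭ oneTo m ++ map (suc m +_) (oneTo r)
tail-↭ m r {w} π↭ = drop-∷ (begin
  suc m ∷ w                                  ↭⟨ π↭ ⟩
  oneTo (suc m + r)                          ≡⟨ oneTo-+ (suc m) r ⟩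
  oneTo (suc m) ++ map (suc m +_) (oneTo r)  ↭⟨ ++⁺ʳ _ (cycle-↭ m) ⟨
  cycle m ++ map (suc m +_) (oneTo r)        ∎)
  where open PermutationReasoning

-- The summand cycle m consists of the first entry m+1 and all smaller entries.
cycle⊕ : ∀ {π} → IsPermutation π → π ≢ [] → Avoids π 231₃ → Avoids π 321₃ →
         ∃₂ λ m τ → IsPermutation τ × π ≡ cycle m ⊕ τ
cycle⊕ {[]}    _  π≢[] _ _ = contradiction refl π≢[]
cycle⊕ {a ∷ w} π↭ _ av231 av321
  with m , m<n , refl ← ∈-applyUpTo⁻ suc (∈-resp-↭ π↭ (here refl))
  with r , m+r≡n ← m≤n⇒∃[o]m+o≡n m<n
  with rest , w≡ , rest↭ ←
    ascending-prefix (AllPairs.applyUpTo⁺₁ suc m (λ i<j _ → s≤s (<⇒≤ i<j)))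
                     (All.applyUpTo⁺₁ suc m s<s)
                     (All.map⁺ (All.applyUpTo⁺₂ suc r (λ _ → m≤m+n (suc m) _)))
                     (ascends-below-head (permutation-unique π↭) av231 av321)
                     (tail-↭ m r (subst (λ n → suc m ∷ w ↭ oneTo n) (sym m+r≡n) π↭))
  with τ , refl , oneTo↭τ ← ↭-map-inv (suc m +_) (↭-sym rest↭)
  = m , τ
  , subst (λ n → τ ↭ oneTo n) (trans (sym (length-applyUpTo suc r)) (↭-length oneTo↭τ)) (↭-sym oneTo↭τ)
  , trans (cong (suc m ∷_) w≡)
          (cong (λ n → cycle m ++ map (n +_) τ) (sym (length-cycle m)))

indecomposable-avoider : ∀ {π} → Indecomposable π → Avoids π 231₃ → Avoids π 321₃ →
                         ∃ λ m → π ≡ cycle m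
indecomposable-avoider (π↭ , π≢[] , indec) av231 av321 with cycle⊕ π↭ π≢[] av231 av321
... | m , []     , _  , π≡ = m , trans π≡ (++-identityʳ (cycle m))
... | m , τ@(_ ∷ _) , τ↭ , π≡ =
  contradiction (cycle m , τ , cycle-isPermutation m , (λ ()) , τ↭ , (λ ()) , π≡) indec

-- The permutation (m+1) 1 2 ⋯ m

inversion-at-head : ∀ m {i j} → Inversion (cycle m) (i , j) → i ≡ zero
inversion-at-head m {zero}          _ = refl
inversion-at-head m {suc i} {suc j} (s≤s i<j , i>j)
  rewrite lookup-applyUpTo suc m i | lookup-applyUpTo suc m j
  = contradiction i>j (<-asym (s<s i<j))

head-inversion : ∀ m j → Inversion (cycle m) (zero , suc j)
head-inversion m j with _ , i<m , eq ← ∈-applyUpTo⁻ suc (∈-lookup {xs = oneTo m} j) =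
  z<s , s≤s (≤-trans (≤-reflexive eq) i<m)

-- The pairs (i , j) are counted by rows: all of row 0 except (0 , 0) consists of
-- inversions, and the other rows contain none.
#inversions-cycle : ∀ m → #inversions (cycle m) ≡ m
#inversions-cycle m = begin
  length (filter inv? (row₀ ++ lowerRows))
    ≡⟨ cong length (filter-++ inv? row₀ lowerRows) ⟩
  length (filter inv? row₀ ++ filter inv? lowerRows)
    ≡⟨ cong (λ ps → length (filter inv? row₀ ++ ps)) (filter-none inv? lowerRows-none) ⟩
  length (filter inv? row₀ ++ [])
    ≡⟨ cong length (++-identityʳ (filter inv? row₀)) ⟩
  -- The pair (zero , zero) at the front of row₀ is dropped by computation.
  length (filter inv? (map (zero ,_) positive))
    ≡⟨ cong length (filter-all inv? row₀-all) ⟩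
  length (map (zero ,_) positive)
    ≡⟨ length-map (zero ,_) positive ⟩
  length positive
    ≡⟨ length-tabulate {n = length (oneTo m)} suc ⟩
  length (oneTo m)
    ≡⟨ length-applyUpTo suc m ⟩
  m ∎
  where
  open ≡-Reasoning
  Position = Fin (length (cycle m))
  inv?     = inversion? (cycle m)

  positive : List Position
  positive = tabulate suc

  row₀ lowerRows : List (Position × Position)
  row₀      = map (zero ,_) (allFin (length (cycle m)))
  lowerRows = cartesianProduct positive (allFin (length (cycle m)))

  row₀-all : All (Inversion (cycle m)) (map (zero ,_) positive)
  row₀-all = All.map⁺ (All.tabulate⁺ (head-inversion m))

  positive-≢0 : All (_≢ zero) positive
  positive-≢0 = All.tabulate⁺ (λ _ ())

  lowerRows-none : All (λ p → ¬ Inversion (cycle m) p) lowerRows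
  lowerRows-none = All.cartesianProduct⁺ (setoid _) (setoid _) positive _
    (λ i∈ _ inv → All.lookup positive-≢0 i∈ (inversion-at-head m inv))

-- The letters y z of an occurrence would form an inversion starting at the first
-- position, leaving no room for x in front of it.
cycle-avoids : ∀ m {x y z} → z < y → Avoids (cycle m) (x ∷ y ∷ z ∷ [])
cycle-avoids m z<y (f , mono , order) =
  contradiction (subst (f zero Fin.<_) f1≡0 (mono z<s)) (λ ())
  where
  f1≡0 : f (suc zero) ≡ zero
  f1≡0 = inversion-at-head m
    (mono {suc zero} {suc (suc zero)} ≤-refl ,
     Equivalence.to (order (suc (suc zero)) (suc zero)) z<y)

cycle-indecomposable : ∀ m → Indecomposable (cycle m)
cycle-indecomposable m = cycle-isPermutation m , (λ ()) , indec
  where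
  indec : ¬ Decomposable (cycle m)
  indec ([]    , _  , _ , ρ≢[] , _)            = ρ≢[] refl
  indec (_ ∷ _ , [] , _ , _    , _ , τ≢[] , _) = τ≢[] refl
  indec (ρ@(a ∷ _) , τ@(_ ∷ _) , ρ↭ , _ , _ , _ , eq) with refl ← cong (take 1) eq =
    <⇒≱ (m<m+n (length ρ) {length τ} z<s) (≤-trans (≤-reflexive |ρ|+|τ|≡1+m) (permutation-≤ ρ↭ (here refl)))
    where
    |ρ|+|τ|≡1+m : length ρ + length τ ≡ suc m
    |ρ|+|τ|≡1+m = begin
      length ρ + length τ                         ≡⟨ cong (length ρ +_) (length-map (length ρ +_) τ) ⟨
      length ρ + length (map (length ρ +_) τ)     ≡⟨ length-++ ρ ⟨
      length (ρ ⊕ τ)                              ≡⟨ cong length eq ⟨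
      length (cycle m)                            ≡⟨ length-cycle m ⟩
      suc m                                       ∎
      where open ≡-Reasoning

I≐cycle : ∀ k → I k (231₃ ∷ 321₃ ∷ []) ≐ ｛ cycle k ｝
I≐cycle k = to , from
  where
  to : ∀ {π} → I k (231₃ ∷ 321₃ ∷ []) π → cycle k ≡ π
  to (indec , inv≡k , av231 ∷ av321 ∷ []) with indecomposable-avoider indec av231 av321
  ... | m , refl = cong cycle (trans (sym inv≡k) (#inversions-cycle m))

  from : ∀ {π} → cycle k ≡ π → I k (231₃ ∷ 321₃ ∷ []) π
  from refl = cycle-indecomposable k , #inversions-cycle k
            , cycle-avoids k (s≤s z<s) ∷ cycle-avoids k ≤-refl ∷ []

theorem10 : (k : ℕ) →
    HasCardinality (I k ((2 ∷ 3 ∷ 1 ∷ []) ∷ (3 ∷ 2 ∷ 1 ∷ []) ∷ [])) 1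
    × I k ((2 ∷ 3 ∷ 1 ∷ []) ∷ (3 ∷ 2 ∷ 1 ∷ []) ∷ []) ≐ ｛ suc k ∷ oneTo k ｝
theorem10 k = (cycle k ∷ [] , [] ∷ [] , member , refl) , I≐cycle k
  where
  member : ∀ π → π ∈ cycle k ∷ [] ⇔ I k (231₃ ∷ 321₃ ∷ []) π
  member π = mk⇔ (λ { (here π≡) → proj₂ (I≐cycle k) (sym π≡) ; (there ()) })
                 (λ π∈I → here (sym (proj₁ (I≐cycle k) π∈I)))
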